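{- The following equations are derivable in equational logic from $\mathrm{EqMSCL}$: (M3) $((x\land_s y)\lor_s(\neg x\land_s z))\land_s u=(x\land_s(y\land_s u))\lor_s(\neg x\land_s(z\land_s u))$, (LD) $x\land_s(y\lor_s z)=(x\land_s y)\lor_s(x\land_s z)$.
   Context: $A$ is a non-empty set of atoms; terms are over the signature $\Sigma_{SCL}(A)=\{\land_s,\lor_s,\neg,\mathsf T,\mathsf F\}\cup A$ with variables. $\mathrm{EqMSCL}$ is the set of axioms (Neg) $\mathsf F=\neg\mathsf T$, (Or) $x\lor_s y=\neg(\neg x\land_s\neg y)$, (Tand) $\mathsf T\land_s x=x$, (Abs) $x\land_s(x\lor_s y)=x$, (Mem) $(x\lor_s y)\land_s z=(\neg x\land_s(y\land_s z))\lor_s(x\land_s z)$. -}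

module Defs where

open import Data.Nat using (ℕ)

data Term (A : Set) : Set where
  var  : ℕ → Term A
  atom : A → Term A
  T    : Term A
  F    : Term A
  ¬ₛ_  : Term A → Term A
  _∧ₛ_ : Term A → Term A → Term A
  _∨ₛ_ : Term A → Term A → Term A

infix  9 ¬ₛ_
infixr 7 _∧ₛ_
infixr 6 _∨ₛ_

Subst : Set → Set
Subst A = ℕ → Term A

_[_] : {A : Set} → Term A → Subst A → Term A
var n    [ σ ] = σ n
atom a   [ σ ] = atom a
T        [ σ ] = T
F        [ σ ] = F
(¬ₛ t)   [ σ ] = ¬ₛ (t [ σ ])
(t ∧ₛ u) [ σ ] = (t [ σ ]) ∧ₛ (u [ σ ])
(t ∨ₛ u) [ σ ] = (t [ σ ]) ∨ₛ (u [ σ ])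

x y z u : {A : Set} → Term A
x = var 0
y = var 1
z = var 2
u = var 3

data EqMSCL {A : Set} : Term A → Term A → Set where
  Neg  : EqMSCL F (¬ₛ T)
  Or   : EqMSCL (x ∨ₛ y) (¬ₛ ((¬ₛ x) ∧ₛ (¬ₛ y)))
  Tand : EqMSCL (T ∧ₛ x) x
  Abs  : EqMSCL (x ∧ₛ (x ∨ₛ y)) x
  Mem  : EqMSCL ((x ∨ₛ y) ∧ₛ z)
                (((¬ₛ x) ∧ₛ (y ∧ₛ z)) ∨ₛ (x ∧ₛ z))

infix 4 _⊢≈_
data _⊢≈_ {A : Set} : Term A → Term A → Set where
  ax    : ∀ {s t} → EqMSCL s t → (σ : Subst A) → s [ σ ] ⊢≈ t [ σ ]
  refl≈ : ∀ {t} → t ⊢≈ t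
  sym≈  : ∀ {s t} → s ⊢≈ t → t ⊢≈ s
  trans≈ : ∀ {s t u} → s ⊢≈ t → t ⊢≈ u → s ⊢≈ u
  cong¬ : ∀ {s t} → s ⊢≈ t → ¬ₛ s ⊢≈ ¬ₛ t
  cong∧ : ∀ {s s' t t'} → s ⊢≈ s' → t ⊢≈ t' → s ∧ₛ t ⊢≈ s' ∧ₛ t'
  cong∨ : ∀ {s s' t t'} → s ⊢≈ s' → t ⊢≈ t' → s ∨ₛ t ⊢≈ s' ∨ₛ t'

{-# OPTIONS --safe #-}
-- Call b and c equal under a when a ∧ b ≈ a ∧ c.  Since a ∧ (¬ a ∨ b) ≈ a ∧ b, this relation is
-- preserved by negating b and c.  The key fact is memorization, a ∧ (b ∧ (a ∨ c)) ≈ a ∧ b: once a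
-- has been found true, evaluating a ∨ c again changes nothing.  It is obtained from the weak
-- associativity (a ∧ b) ∧ c ≈ a ∧ (b ∧ ((a ∧ b) ∧ c)), and with (Mem) it yields full associativity,
-- after which (M3) and (LD) are short computations.
module Submission where

open import Defs
open import Data.Nat using (zero; suc)
open import Data.Product using (_×_; _,_)
open import Level using (0ℓ)
open import Relation.Binary.Bundles using (Setoid)
import Relation.Binary.Reasoning.Setoid as SetoidReasoning

module _ {A : Set} where

  -- Equational reasoning and instances of the axioms

  ⊢≈-setoid : Setoid 0ℓ 0ℓ
  ⊢≈-setoid = record
    { Carrier       = Term A
    ; _≈_           = _⊢≈_
    ; isEquivalence = record { refl = refl≈ ; sym = sym≈ ; trans = trans≈ }
    }

  open SetoidReasoning ⊢≈-setoid

  private variable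
    a b c d : Term A

  ∧-congˡ : b ⊢≈ c → a ∧ₛ b ⊢≈ a ∧ₛ c
  ∧-congˡ = cong∧ refl≈

  ∧-congʳ : b ⊢≈ c → b ∧ₛ a ⊢≈ c ∧ₛ a
  ∧-congʳ p = cong∧ p refl≈

  ∨-congˡ : b ⊢≈ c → a ∨ₛ b ⊢≈ a ∨ₛ c
  ∨-congˡ = cong∨ refl≈

  ∨-congʳ : b ⊢≈ c → b ∨ₛ a ⊢≈ c ∨ₛ a
  ∨-congʳ p = cong∨ p refl≈

  instantiate : Term A → Term A → Term A → Subst A
  instantiate a b c zero          = a
  instantiate a b c (suc zero)    = b
  -- Only the variables 0, 1 and 2 occur in the axioms, so `c` doubles as the default from index 2
  -- on.
  instantiate a b c (suc (suc _)) = c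

  F≈¬T : F ⊢≈ ¬ₛ T {A}
  F≈¬T = ax Neg var

  ∨-def : a ∨ₛ b ⊢≈ ¬ₛ (¬ₛ a ∧ₛ ¬ₛ b)
  ∨-def {a} {b} = ax Or (instantiate a b b)

  ∧-identityˡ : T ∧ₛ a ⊢≈ a
  ∧-identityˡ {a} = ax Tand (instantiate a a a)

  ∧-absorbs-∨ : a ∧ₛ (a ∨ₛ b) ⊢≈ a
  ∧-absorbs-∨ {a} {b} = ax Abs (instantiate a b b)

  ∨-∧-mem : (a ∨ₛ b) ∧ₛ c ⊢≈ (¬ₛ a ∧ₛ (b ∧ₛ c)) ∨ₛ (a ∧ₛ c)
  ∨-∧-mem {a} {b} {c} = ax Mem (instantiate a b c)

  -- Negation and duality

  ∨-zeroˡ : T ∨ₛ a ⊢≈ T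
  ∨-zeroˡ = trans≈ (sym≈ ∧-identityˡ) ∧-absorbs-∨

  -- A provisional form of `F ∧ a ≈ F`: its negations can be removed only once double negation is
  -- available.
  ¬[F∧¬a]≈T : ¬ₛ (F ∧ₛ ¬ₛ a) ⊢≈ T
  ¬[F∧¬a]≈T {a} = begin
    ¬ₛ (F ∧ₛ ¬ₛ a)    ≈⟨ cong¬ (∧-congʳ F≈¬T) ⟩
    ¬ₛ (¬ₛ T ∧ₛ ¬ₛ a) ≈⟨ ∨-def ⟨
    T ∨ₛ a            ≈⟨ ∨-zeroˡ ⟩
    T                 ∎

  [F∧a]∨a≈a : (F ∧ₛ a) ∨ₛ a ⊢≈ a
  [F∧a]∨a≈a {a} = begin
    (F ∧ₛ a) ∨ₛ a                    ≈⟨ cong∨ (cong∧ F≈¬T (sym≈ ∧-identityˡ)) (sym≈ ∧-identityˡ) ⟩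
    (¬ₛ T ∧ₛ (T ∧ₛ a)) ∨ₛ (T ∧ₛ a)   ≈⟨ ∨-∧-mem ⟨
    (T ∨ₛ T) ∧ₛ a                    ≈⟨ ∧-congʳ ∨-zeroˡ ⟩
    T ∧ₛ a                           ≈⟨ ∧-identityˡ ⟩
    a                                ∎

  ¬-involutive-¬ : ¬ₛ ¬ₛ ¬ₛ a ⊢≈ ¬ₛ a
  ¬-involutive-¬ {a} = begin
    ¬ₛ ¬ₛ ¬ₛ a                       ≈⟨ cong¬ ∧-identityˡ ⟨
    -- Expanding `T` produces the right-hand side of (Or) at `F ∧ ¬ a` and `¬ a`.
    ¬ₛ (T ∧ₛ ¬ₛ ¬ₛ a)                ≈⟨ cong¬ (∧-congʳ ¬[F∧¬a]≈T) ⟨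
    ¬ₛ (¬ₛ (F ∧ₛ ¬ₛ a) ∧ₛ ¬ₛ ¬ₛ a)   ≈⟨ ∨-def ⟨
    (F ∧ₛ ¬ₛ a) ∨ₛ ¬ₛ a              ≈⟨ [F∧a]∨a≈a ⟩
    ¬ₛ a                             ∎

  -- Every term is provably equal to a disjunction, hence to a negation.
  ¬-involutive : ¬ₛ ¬ₛ a ⊢≈ a
  ¬-involutive {a} = begin
    ¬ₛ ¬ₛ a                                   ≈⟨ cong¬ (cong¬ a≈¬) ⟩
    ¬ₛ ¬ₛ ¬ₛ (¬ₛ (F ∧ₛ a) ∧ₛ ¬ₛ a)            ≈⟨ ¬-involutive-¬ ⟩
    ¬ₛ (¬ₛ (F ∧ₛ a) ∧ₛ ¬ₛ a)                  ≈⟨ a≈¬ ⟨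
    a                                         ∎
    where
    a≈¬ : a ⊢≈ ¬ₛ (¬ₛ (F ∧ₛ a) ∧ₛ ¬ₛ a)
    a≈¬ = trans≈ (sym≈ [F∧a]∨a≈a) ∨-def

  ¬-∨ : ¬ₛ (a ∨ₛ b) ⊢≈ ¬ₛ a ∧ₛ ¬ₛ b
  ¬-∨ = trans≈ (cong¬ ∨-def) ¬-involutive

  ¬-∧ : ¬ₛ (a ∧ₛ b) ⊢≈ ¬ₛ a ∨ₛ ¬ₛ b
  ¬-∧ = sym≈ (trans≈ ∨-def (cong¬ (cong∧ ¬-involutive ¬-involutive)))

  ¬T≈F : ¬ₛ T ⊢≈ F {A}
  ¬T≈F = sym≈ F≈¬T

  ¬F≈T : ¬ₛ F ⊢≈ T {A}
  ¬F≈T = trans≈ (cong¬ F≈¬T) ¬-involutive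

  ∧-zeroˡ : F ∧ₛ a ⊢≈ F
  ∧-zeroˡ {a} = begin
    F ∧ₛ a                  ≈⟨ ∧-congˡ ¬-involutive ⟨
    F ∧ₛ ¬ₛ ¬ₛ a            ≈⟨ ¬-involutive ⟨
    ¬ₛ ¬ₛ (F ∧ₛ ¬ₛ ¬ₛ a)    ≈⟨ cong¬ ¬[F∧¬a]≈T ⟩
    ¬ₛ T                    ≈⟨ ¬T≈F ⟩
    F                       ∎

  ∨-identityˡ : F ∨ₛ a ⊢≈ a
  ∨-identityˡ = trans≈ (∨-congʳ (sym≈ ∧-zeroˡ)) [F∧a]∨a≈a

  ∨-identityʳ : a ∨ₛ F ⊢≈ a
  ∨-identityʳ {a} = begin
    a ∨ₛ F                          ≈⟨ cong∨ (trans≈ (∧-congʳ ¬F≈T) (trans≈ ∧-identityˡ ∧-identityˡ)) ∧-zeroˡ ⟨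
    (¬ₛ F ∧ₛ (T ∧ₛ a)) ∨ₛ (F ∧ₛ a)  ≈⟨ ∨-∧-mem ⟨
    (F ∨ₛ T) ∧ₛ a                   ≈⟨ ∧-congʳ ∨-identityˡ ⟩
    T ∧ₛ a                          ≈⟨ ∧-identityˡ ⟩
    a                               ∎

  ∧-identityʳ : a ∧ₛ T ⊢≈ a
  ∧-identityʳ {a} = begin
    a ∧ₛ T            ≈⟨ ¬-involutive ⟨
    ¬ₛ ¬ₛ (a ∧ₛ T)    ≈⟨ cong¬ ¬-∧ ⟩
    ¬ₛ (¬ₛ a ∨ₛ ¬ₛ T) ≈⟨ cong¬ (∨-congˡ ¬T≈F) ⟩
    ¬ₛ (¬ₛ a ∨ₛ F)    ≈⟨ cong¬ ∨-identityʳ ⟩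
    ¬ₛ ¬ₛ a           ≈⟨ ¬-involutive ⟩
    a                 ∎

  ∨-absorbs-∧ : a ∨ₛ (a ∧ₛ b) ⊢≈ a
  ∨-absorbs-∧ {a} {b} = begin
    a ∨ₛ (a ∧ₛ b)                 ≈⟨ ∨-def ⟩
    ¬ₛ (¬ₛ a ∧ₛ ¬ₛ (a ∧ₛ b))      ≈⟨ cong¬ (∧-congˡ ¬-∧) ⟩
    ¬ₛ (¬ₛ a ∧ₛ (¬ₛ a ∨ₛ ¬ₛ b))   ≈⟨ cong¬ ∧-absorbs-∨ ⟩
    ¬ₛ ¬ₛ a                       ≈⟨ ¬-involutive ⟩
    a                             ∎

  -- The De Morgan dual of (Mem), obtained by applying (Mem) under a negation.
  ∧-∨-mem : (a ∧ₛ b) ∨ₛ c ⊢≈ (¬ₛ a ∨ₛ (b ∨ₛ c)) ∧ₛ (a ∨ₛ c)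
  ∧-∨-mem {a} {b} {c} = begin
    (a ∧ₛ b) ∨ₛ c                                           ≈⟨ ∨-def ⟩
    ¬ₛ (¬ₛ (a ∧ₛ b) ∧ₛ ¬ₛ c)                                ≈⟨ cong¬ (∧-congʳ ¬-∧) ⟩
    ¬ₛ ((¬ₛ a ∨ₛ ¬ₛ b) ∧ₛ ¬ₛ c)                             ≈⟨ cong¬ ∨-∧-mem ⟩
    ¬ₛ ((¬ₛ ¬ₛ a ∧ₛ (¬ₛ b ∧ₛ ¬ₛ c)) ∨ₛ (¬ₛ a ∧ₛ ¬ₛ c))      ≈⟨ ¬-∨ ⟩
    ¬ₛ (¬ₛ ¬ₛ a ∧ₛ (¬ₛ b ∧ₛ ¬ₛ c)) ∧ₛ ¬ₛ (¬ₛ a ∧ₛ ¬ₛ c)     ≈⟨ cong∧ (cong¬ (∧-congˡ ¬-∨)) ∨-def ⟨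
    ¬ₛ (¬ₛ ¬ₛ a ∧ₛ ¬ₛ (b ∨ₛ c)) ∧ₛ (a ∨ₛ c)                 ≈⟨ ∧-congʳ ∨-def ⟨
    (¬ₛ a ∨ₛ (b ∨ₛ c)) ∧ₛ (a ∨ₛ c)                          ∎

  ∧-idem : a ∧ₛ a ⊢≈ a
  ∧-idem {a} = trans≈ (∧-congˡ (sym≈ (∨-absorbs-∧ {b = a}))) ∧-absorbs-∨

  ∨-idem : a ∨ₛ a ⊢≈ a
  ∨-idem {a} = trans≈ (∨-congˡ (sym≈ (∧-absorbs-∨ {b = a}))) ∨-absorbs-∧

  -- The terms a ∧ F and a ∨ T

  -- The dual of (Mem) with `F` as last argument. It lets the test of `a` move between the front and
  -- the back.
  [¬a∨b]∧a≈a∧b : (¬ₛ a ∨ₛ b) ∧ₛ a ⊢≈ a ∧ₛ b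
  [¬a∨b]∧a≈a∧b {a} {b} = begin
    (¬ₛ a ∨ₛ b) ∧ₛ a                 ≈⟨ cong∧ (∨-congˡ ∨-identityʳ) ∨-identityʳ ⟨
    (¬ₛ a ∨ₛ (b ∨ₛ F)) ∧ₛ (a ∨ₛ F)   ≈⟨ ∧-∨-mem ⟨
    (a ∧ₛ b) ∨ₛ F                    ≈⟨ ∨-identityʳ ⟩
    a ∧ₛ b                           ∎

  [¬a∧b]∨a≈a∨b : (¬ₛ a ∧ₛ b) ∨ₛ a ⊢≈ a ∨ₛ b
  [¬a∧b]∨a≈a∨b {a} {b} = begin
    (¬ₛ a ∧ₛ b) ∨ₛ a                 ≈⟨ cong∨ (∧-congˡ ∧-identityʳ) ∧-identityʳ ⟨
    (¬ₛ a ∧ₛ (b ∧ₛ T)) ∨ₛ (a ∧ₛ T)   ≈⟨ ∨-∧-mem ⟨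
    (a ∨ₛ b) ∧ₛ T                    ≈⟨ ∧-identityʳ ⟩
    a ∨ₛ b                           ∎

  ¬a∧a≈a∧F : ¬ₛ a ∧ₛ a ⊢≈ a ∧ₛ F
  ¬a∧a≈a∧F = trans≈ (∧-congʳ (sym≈ ∨-identityʳ)) [¬a∨b]∧a≈a∧b

  a∧¬a≈a∧F : a ∧ₛ ¬ₛ a ⊢≈ a ∧ₛ F
  a∧¬a≈a∧F {a} = begin
    a ∧ₛ ¬ₛ a              ≈⟨ [¬a∨b]∧a≈a∧b ⟨
    (¬ₛ a ∨ₛ ¬ₛ a) ∧ₛ a    ≈⟨ ∧-congʳ ∨-idem ⟩
    ¬ₛ a ∧ₛ a              ≈⟨ ¬a∧a≈a∧F ⟩
    a ∧ₛ F                 ∎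

  -- `a ∧ F` evaluates `a` and returns `F` for either value, so it cannot distinguish `a` from
  -- `¬ a`.
  ¬a∧F≈a∧F : ¬ₛ a ∧ₛ F ⊢≈ a ∧ₛ F
  ¬a∧F≈a∧F {a} = begin
    ¬ₛ a ∧ₛ F         ≈⟨ a∧¬a≈a∧F ⟨
    ¬ₛ a ∧ₛ ¬ₛ ¬ₛ a   ≈⟨ ∧-congˡ ¬-involutive ⟩
    ¬ₛ a ∧ₛ a         ≈⟨ ¬a∧a≈a∧F ⟩
    a ∧ₛ F            ∎

  ¬[a∨T]≈a∧F : ¬ₛ (a ∨ₛ T) ⊢≈ a ∧ₛ F
  ¬[a∨T]≈a∧F = trans≈ ¬-∨ (trans≈ (∧-congˡ ¬T≈F) ¬a∧F≈a∧F)

  ¬[a∧F]≈a∨T : ¬ₛ (a ∧ₛ F) ⊢≈ a ∨ₛ T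
  ¬[a∧F]≈a∨T = trans≈ (cong¬ (sym≈ ¬[a∨T]≈a∧F)) ¬-involutive

  -- With the test of `¬ a` moved to the back, absorption deletes `b`.
  ¬a∧[a∧b]≈a∧F : ¬ₛ a ∧ₛ (a ∧ₛ b) ⊢≈ a ∧ₛ F
  ¬a∧[a∧b]≈a∧F {a} {b} = begin
    ¬ₛ a ∧ₛ (a ∧ₛ b)                 ≈⟨ [¬a∨b]∧a≈a∧b ⟨
    (¬ₛ ¬ₛ a ∨ₛ (a ∧ₛ b)) ∧ₛ ¬ₛ a    ≈⟨ ∧-congʳ (∨-congʳ ¬-involutive) ⟩
    (a ∨ₛ (a ∧ₛ b)) ∧ₛ ¬ₛ a          ≈⟨ ∧-congʳ ∨-absorbs-∧ ⟩
    a ∧ₛ ¬ₛ a                        ≈⟨ a∧¬a≈a∧F ⟩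
    a ∧ₛ F                           ∎

  -- (Mem) applied to `(a ∨ a) ∧ b`: its first branch is `¬ a ∧ (a ∧ b)`, which amounts to `a ∧ F`.
  [a∧F]∨[a∧b]≈a∧b : (a ∧ₛ F) ∨ₛ (a ∧ₛ b) ⊢≈ a ∧ₛ b
  [a∧F]∨[a∧b]≈a∧b {a} {b} = begin
    (a ∧ₛ F) ∨ₛ (a ∧ₛ b)             ≈⟨ ∨-congʳ ¬a∧[a∧b]≈a∧F ⟨
    (¬ₛ a ∧ₛ (a ∧ₛ b)) ∨ₛ (a ∧ₛ b)   ≈⟨ ∨-∧-mem ⟨
    (a ∨ₛ a) ∧ₛ b                    ≈⟨ ∧-congʳ ∨-idem ⟩
    a ∧ₛ b                           ∎

  [a∨T]∧b≈[¬a∧b]∨[a∧b] : (a ∨ₛ T) ∧ₛ b ⊢≈ (¬ₛ a ∧ₛ b) ∨ₛ (a ∧ₛ b)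
  [a∨T]∧b≈[¬a∧b]∨[a∧b] = trans≈ ∨-∧-mem (∨-congʳ (∧-congˡ ∧-identityˡ))

  [a∨T]∧F≈a∧F : (a ∨ₛ T) ∧ₛ F ⊢≈ a ∧ₛ F
  [a∨T]∧F≈a∧F {a} = begin
    (a ∨ₛ T) ∧ₛ F              ≈⟨ [a∨T]∧b≈[¬a∧b]∨[a∧b] ⟩
    (¬ₛ a ∧ₛ F) ∨ₛ (a ∧ₛ F)    ≈⟨ ∨-congʳ ¬a∧F≈a∧F ⟩
    (a ∧ₛ F) ∨ₛ (a ∧ₛ F)       ≈⟨ ∨-idem ⟩
    a ∧ₛ F                     ∎

  [a∧F]∧F≈a∧F : (a ∧ₛ F) ∧ₛ F ⊢≈ a ∧ₛ F
  [a∧F]∧F≈a∧F {a} = begin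
    (a ∧ₛ F) ∧ₛ F       ≈⟨ ¬a∧F≈a∧F ⟨
    ¬ₛ (a ∧ₛ F) ∧ₛ F    ≈⟨ ∧-congʳ ¬[a∧F]≈a∨T ⟩
    (a ∨ₛ T) ∧ₛ F       ≈⟨ [a∨T]∧F≈a∧F ⟩
    a ∧ₛ F              ∎

  [a∧F]∧b≈a∧F : (a ∧ₛ F) ∧ₛ b ⊢≈ a ∧ₛ F
  [a∧F]∧b≈a∧F {a} {b} = begin
    (a ∧ₛ F) ∧ₛ b                        ≈⟨ [a∧F]∨[a∧b]≈a∧b ⟨
    ((a ∧ₛ F) ∧ₛ F) ∨ₛ ((a ∧ₛ F) ∧ₛ b)   ≈⟨ ∨-congʳ [a∧F]∧F≈a∧F ⟩
    (a ∧ₛ F) ∨ₛ ((a ∧ₛ F) ∧ₛ b)          ≈⟨ ∨-absorbs-∧ ⟩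
    a ∧ₛ F                               ∎

  [a∨T]∨b≈a∨T : (a ∨ₛ T) ∨ₛ b ⊢≈ a ∨ₛ T
  [a∨T]∨b≈a∨T {a} {b} = begin
    (a ∨ₛ T) ∨ₛ b                 ≈⟨ ∨-def ⟩
    ¬ₛ (¬ₛ (a ∨ₛ T) ∧ₛ ¬ₛ b)      ≈⟨ cong¬ (∧-congʳ ¬[a∨T]≈a∧F) ⟩
    ¬ₛ ((a ∧ₛ F) ∧ₛ ¬ₛ b)         ≈⟨ cong¬ [a∧F]∧b≈a∧F ⟩
    ¬ₛ (a ∧ₛ F)                   ≈⟨ ¬[a∧F]≈a∨T ⟩
    a ∨ₛ T                        ∎

  [a∧F]∨T≈a∨T : (a ∧ₛ F) ∨ₛ T ⊢≈ a ∨ₛ T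
  [a∧F]∨T≈a∨T {a} = begin
    (a ∧ₛ F) ∨ₛ T           ≈⟨ ¬[a∧F]≈a∨T ⟨
    ¬ₛ ((a ∧ₛ F) ∧ₛ F)      ≈⟨ cong¬ [a∧F]∧F≈a∧F ⟩
    ¬ₛ (a ∧ₛ F)             ≈⟨ ¬[a∧F]≈a∨T ⟩
    a ∨ₛ T                  ∎

  [a∨T]∧[a∧b]≈a∧b : (a ∨ₛ T) ∧ₛ (a ∧ₛ b) ⊢≈ a ∧ₛ b
  [a∨T]∧[a∧b]≈a∧b {a} {b} = begin
    -- `a ∨ T` swallows any further disjunct; `F ∨ (a ∧ b)` is the one that leads to the shape of
    -- `∧-∨-mem`.
    (a ∨ₛ T) ∧ₛ (a ∧ₛ b)                                          ≈⟨ ∧-congʳ [a∨T]∨b≈a∨T ⟨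
    ((a ∨ₛ T) ∨ₛ (F ∨ₛ (a ∧ₛ b))) ∧ₛ (a ∧ₛ b)                     ≈⟨ cong∧ (∨-congʳ ¬[a∧F]≈a∨T) [a∧F]∨[a∧b]≈a∧b ⟨
    (¬ₛ (a ∧ₛ F) ∨ₛ (F ∨ₛ (a ∧ₛ b))) ∧ₛ ((a ∧ₛ F) ∨ₛ (a ∧ₛ b))    ≈⟨ ∧-∨-mem ⟨
    ((a ∧ₛ F) ∧ₛ F) ∨ₛ (a ∧ₛ b)                                   ≈⟨ ∨-congʳ [a∧F]∧F≈a∧F ⟩
    (a ∧ₛ F) ∨ₛ (a ∧ₛ b)                                          ≈⟨ [a∧F]∨[a∧b]≈a∧b ⟩
    a ∧ₛ b                                                        ∎

  -- Serves to discard the `a ∧ F` that (Mem) leaves as its second branch.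
  [a∧b]∨[a∧F]≈a∧b : (a ∧ₛ b) ∨ₛ (a ∧ₛ F) ⊢≈ a ∧ₛ b
  [a∧b]∨[a∧F]≈a∧b {a} {b} = begin
    (a ∧ₛ b) ∨ₛ (a ∧ₛ F)                     ≈⟨ ∨-congʳ [a∨T]∧[a∧b]≈a∧b ⟨
    ((a ∨ₛ T) ∧ₛ (a ∧ₛ b)) ∨ₛ (a ∧ₛ F)       ≈⟨ ∨-congʳ (∧-congʳ ¬[a∧F]≈a∨T) ⟨
    (¬ₛ (a ∧ₛ F) ∧ₛ (a ∧ₛ b)) ∨ₛ (a ∧ₛ F)    ≈⟨ [¬a∧b]∨a≈a∨b ⟩
    (a ∧ₛ F) ∨ₛ (a ∧ₛ b)                     ≈⟨ [a∧F]∨[a∧b]≈a∧b ⟩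
    a ∧ₛ b                                   ∎

  -- Equality under a term

  a∧[b∧a]≈a∧b : a ∧ₛ (b ∧ₛ a) ⊢≈ a ∧ₛ b
  a∧[b∧a]≈a∧b {a} {b} = begin
    a ∧ₛ (b ∧ₛ a)                              ≈⟨ [a∧b]∨[a∧F]≈a∧b ⟨
    (a ∧ₛ (b ∧ₛ a)) ∨ₛ (a ∧ₛ F)                ≈⟨ cong∨ (∧-congʳ ¬-involutive) ¬a∧a≈a∧F ⟨
    (¬ₛ ¬ₛ a ∧ₛ (b ∧ₛ a)) ∨ₛ (¬ₛ a ∧ₛ a)       ≈⟨ ∨-∧-mem ⟨
    (¬ₛ a ∨ₛ b) ∧ₛ a                           ≈⟨ [¬a∨b]∧a≈a∧b ⟩
    a ∧ₛ b                                     ∎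

  a∧[a∧b]≈a∧b : a ∧ₛ (a ∧ₛ b) ⊢≈ a ∧ₛ b
  a∧[a∧b]≈a∧b {a} {b} = begin
    a ∧ₛ (a ∧ₛ b)                               ≈⟨ [a∧F]∨[a∧b]≈a∧b ⟨
    (a ∧ₛ F) ∨ₛ (a ∧ₛ (a ∧ₛ b))                 ≈⟨ ∨-congʳ ¬a∧[a∧b]≈a∧F ⟨
    (¬ₛ a ∧ₛ (a ∧ₛ b)) ∨ₛ (a ∧ₛ (a ∧ₛ b))       ≈⟨ [a∨T]∧b≈[¬a∧b]∨[a∧b] ⟨
    (a ∨ₛ T) ∧ₛ (a ∧ₛ b)                        ≈⟨ [a∨T]∧[a∧b]≈a∧b ⟩
    a ∧ₛ b                                      ∎

  a∧[¬a∨b]≈a∧b : a ∧ₛ (¬ₛ a ∨ₛ b) ⊢≈ a ∧ₛ b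
  a∧[¬a∨b]≈a∧b {a} {b} = begin
    a ∧ₛ (¬ₛ a ∨ₛ b)           ≈⟨ a∧[b∧a]≈a∧b ⟨
    a ∧ₛ ((¬ₛ a ∨ₛ b) ∧ₛ a)    ≈⟨ ∧-congˡ [¬a∨b]∧a≈a∧b ⟩
    a ∧ₛ (a ∧ₛ b)              ≈⟨ a∧[a∧b]≈a∧b ⟩
    a ∧ₛ b                     ∎

  ¬a∧[a∨b]≈¬a∧b : ¬ₛ a ∧ₛ (a ∨ₛ b) ⊢≈ ¬ₛ a ∧ₛ b
  ¬a∧[a∨b]≈¬a∧b = trans≈ (∧-congˡ (∨-congʳ (sym≈ ¬-involutive))) a∧[¬a∨b]≈a∧b

  a∧¬[a∧b]≈a∧¬b : a ∧ₛ ¬ₛ (a ∧ₛ b) ⊢≈ a ∧ₛ ¬ₛ b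
  a∧¬[a∧b]≈a∧¬b = trans≈ (∧-congˡ ¬-∧) a∧[¬a∨b]≈a∧b

  ¬-cong-under : a ∧ₛ b ⊢≈ a ∧ₛ c → a ∧ₛ ¬ₛ b ⊢≈ a ∧ₛ ¬ₛ c
  ¬-cong-under {a} {b} {c} ab≈ac = begin
    a ∧ₛ ¬ₛ b           ≈⟨ a∧¬[a∧b]≈a∧¬b ⟨
    a ∧ₛ ¬ₛ (a ∧ₛ b)    ≈⟨ ∧-congˡ (cong¬ ab≈ac) ⟩
    a ∧ₛ ¬ₛ (a ∧ₛ c)    ≈⟨ a∧¬[a∧b]≈a∧¬b ⟩
    a ∧ₛ ¬ₛ c           ∎

  -- Weak associativity

  -- After a false `a`, the right factor tests `b` again, so the first test of `b` can be replaced
  -- by `T`.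
  [a∨b]∧[b∧c]≈[a∨T]∧[b∧c] : (a ∨ₛ b) ∧ₛ (b ∧ₛ c) ⊢≈ (a ∨ₛ T) ∧ₛ (b ∧ₛ c)
  [a∨b]∧[b∧c]≈[a∨T]∧[b∧c] {a} {b} {c} = begin
    (a ∨ₛ b) ∧ₛ (b ∧ₛ c)                               ≈⟨ ∨-∧-mem ⟩
    (¬ₛ a ∧ₛ (b ∧ₛ (b ∧ₛ c))) ∨ₛ (a ∧ₛ (b ∧ₛ c))       ≈⟨ ∨-congʳ (∧-congˡ a∧[a∧b]≈a∧b) ⟩
    (¬ₛ a ∧ₛ (b ∧ₛ c)) ∨ₛ (a ∧ₛ (b ∧ₛ c))              ≈⟨ [a∨T]∧b≈[¬a∧b]∨[a∧b] ⟨
    (a ∨ₛ T) ∧ₛ (b ∧ₛ c)                               ∎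

  [a∨T]∧[[a∧b]∧c]≈[a∧b]∧c : (a ∨ₛ T) ∧ₛ ((a ∧ₛ b) ∧ₛ c) ⊢≈ (a ∧ₛ b) ∧ₛ c
  [a∨T]∧[[a∧b]∧c]≈[a∧b]∧c {a} {b} {c} = begin
    -- The first disjunct becomes `a ∧ F` so that exchanging `T` for `a ∧ b` leaves just `a ∧ b`.
    (a ∨ₛ T) ∧ₛ ((a ∧ₛ b) ∧ₛ c)                  ≈⟨ ∧-congʳ [a∧F]∨T≈a∨T ⟨
    ((a ∧ₛ F) ∨ₛ T) ∧ₛ ((a ∧ₛ b) ∧ₛ c)           ≈⟨ [a∨b]∧[b∧c]≈[a∨T]∧[b∧c] ⟨
    ((a ∧ₛ F) ∨ₛ (a ∧ₛ b)) ∧ₛ ((a ∧ₛ b) ∧ₛ c)    ≈⟨ ∧-congʳ [a∧F]∨[a∧b]≈a∧b ⟩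
    (a ∧ₛ b) ∧ₛ ((a ∧ₛ b) ∧ₛ c)                  ≈⟨ a∧[a∧b]≈a∧b ⟩
    (a ∧ₛ b) ∧ₛ c                                ∎

  -- Both disjuncts are brought to begin with `a ∨ (a ∧ b)`, after which absorption applies.
  a∨[[a∧b]∧c]≈a : a ∨ₛ ((a ∧ₛ b) ∧ₛ c) ⊢≈ a
  a∨[[a∧b]∧c]≈a {a} {b} {c} = begin
    a ∨ₛ ((a ∧ₛ b) ∧ₛ c)                                              ≈⟨ cong∨ ∨-absorbs-∧ [a∨T]∧[[a∧b]∧c]≈[a∧b]∧c ⟨
    (a ∨ₛ (a ∧ₛ b)) ∨ₛ ((a ∨ₛ T) ∧ₛ ((a ∧ₛ b) ∧ₛ c))                  ≈⟨ ∨-congˡ [a∨b]∧[b∧c]≈[a∨T]∧[b∧c] ⟨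
    (a ∨ₛ (a ∧ₛ b)) ∨ₛ ((a ∨ₛ (a ∧ₛ b)) ∧ₛ ((a ∧ₛ b) ∧ₛ c))           ≈⟨ ∨-absorbs-∧ ⟩
    a ∨ₛ (a ∧ₛ b)                                                     ≈⟨ ∨-absorbs-∧ ⟩
    a                                                                 ∎

  -- Replacing `a` by `a ∨ v`, for `v = (a ∧ b) ∧ c`, makes (Mem) put `v` in both branches. This is
  -- `(a ∨ T) ∧ v`, and `v` itself starts with `a`.
  a∧[[a∧b]∧c]≈[a∧b]∧c : a ∧ₛ ((a ∧ₛ b) ∧ₛ c) ⊢≈ (a ∧ₛ b) ∧ₛ c
  a∧[[a∧b]∧c]≈[a∧b]∧c {a} {b} {c} = begin
    a ∧ₛ v                               ≈⟨ ∧-congʳ a∨[[a∧b]∧c]≈a ⟨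
    (a ∨ₛ v) ∧ₛ v                        ≈⟨ ∨-∧-mem ⟩
    (¬ₛ a ∧ₛ (v ∧ₛ v)) ∨ₛ (a ∧ₛ v)       ≈⟨ ∨-congʳ (∧-congˡ ∧-idem) ⟩
    (¬ₛ a ∧ₛ v) ∨ₛ (a ∧ₛ v)              ≈⟨ [a∨T]∧b≈[¬a∧b]∨[a∧b] ⟨
    (a ∨ₛ T) ∧ₛ v                        ≈⟨ [a∨T]∧[[a∧b]∧c]≈[a∧b]∧c ⟩
    v                                    ∎
    where
    v = (a ∧ₛ b) ∧ₛ c

  ¬a∧[[a∧b]∧c]≈a∧F : ¬ₛ a ∧ₛ ((a ∧ₛ b) ∧ₛ c) ⊢≈ a ∧ₛ F
  ¬a∧[[a∧b]∧c]≈a∧F = trans≈ (∧-congˡ (sym≈ a∧[[a∧b]∧c]≈[a∧b]∧c)) ¬a∧[a∧b]≈a∧F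

  -- Writing `a ∧ b` as `(¬ a ∨ b) ∧ a` lets `¬ a ∨ b` be repeated in front; (Mem) then splits this
  -- new factor.
  ∧-weak-assoc : (a ∧ₛ b) ∧ₛ c ⊢≈ a ∧ₛ (b ∧ₛ ((a ∧ₛ b) ∧ₛ c))
  ∧-weak-assoc {a} {b} {c} = begin
    v                                            ≈⟨ ∧-congʳ [¬a∨b]∧a≈a∧b ⟨
    ((¬ₛ a ∨ₛ b) ∧ₛ a) ∧ₛ c                      ≈⟨ a∧[[a∧b]∧c]≈[a∧b]∧c ⟨
    (¬ₛ a ∨ₛ b) ∧ₛ (((¬ₛ a ∨ₛ b) ∧ₛ a) ∧ₛ c)     ≈⟨ ∧-congˡ (∧-congʳ [¬a∨b]∧a≈a∧b) ⟩
    (¬ₛ a ∨ₛ b) ∧ₛ v                             ≈⟨ ∨-∧-mem ⟩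
    (¬ₛ ¬ₛ a ∧ₛ (b ∧ₛ v)) ∨ₛ (¬ₛ a ∧ₛ v)         ≈⟨ cong∨ (∧-congʳ ¬-involutive) ¬a∧[[a∧b]∧c]≈a∧F ⟩
    (a ∧ₛ (b ∧ₛ v)) ∨ₛ (a ∧ₛ F)                  ≈⟨ [a∧b]∨[a∧F]≈a∧b ⟩
    a ∧ₛ (b ∧ₛ v)                                ∎
    where
    v = (a ∧ₛ b) ∧ₛ c

  -- Memorization and associativity

  [a∧b]∧b≈a∧b : (a ∧ₛ b) ∧ₛ b ⊢≈ a ∧ₛ b
  [a∧b]∧b≈a∧b {a} {b} = begin
    (a ∧ₛ b) ∧ₛ b                    ≈⟨ ∧-weak-assoc ⟩
    a ∧ₛ (b ∧ₛ ((a ∧ₛ b) ∧ₛ b))      ≈⟨ ∧-congˡ (trans≈ a∧[b∧a]≈a∧b a∧[b∧a]≈a∧b) ⟩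
    a ∧ₛ (b ∧ₛ a)                    ≈⟨ a∧[b∧a]≈a∧b ⟩
    a ∧ₛ b                           ∎

  [a∨[b∧c]]∧c≈[a∨b]∧c : (a ∨ₛ (b ∧ₛ c)) ∧ₛ c ⊢≈ (a ∨ₛ b) ∧ₛ c
  [a∨[b∧c]]∧c≈[a∨b]∧c {a} {b} {c} = begin
    (a ∨ₛ (b ∧ₛ c)) ∧ₛ c                         ≈⟨ ∨-∧-mem ⟩
    (¬ₛ a ∧ₛ ((b ∧ₛ c) ∧ₛ c)) ∨ₛ (a ∧ₛ c)        ≈⟨ ∨-congʳ (∧-congˡ [a∧b]∧b≈a∧b) ⟩
    (¬ₛ a ∧ₛ (b ∧ₛ c)) ∨ₛ (a ∧ₛ c)               ≈⟨ ∨-∧-mem ⟨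
    (a ∨ₛ b) ∧ₛ c                                ∎

  -- The leading `a` is copied to the end, where it makes the inner `a` redundant, and is then
  -- removed again.
  a∧[b∨[c∧a]]≈a∧[b∨c] : a ∧ₛ (b ∨ₛ (c ∧ₛ a)) ⊢≈ a ∧ₛ (b ∨ₛ c)
  a∧[b∨[c∧a]]≈a∧[b∨c] {a} {b} {c} = begin
    a ∧ₛ (b ∨ₛ (c ∧ₛ a))           ≈⟨ a∧[b∧a]≈a∧b ⟨
    a ∧ₛ ((b ∨ₛ (c ∧ₛ a)) ∧ₛ a)    ≈⟨ ∧-congˡ [a∨[b∧c]]∧c≈[a∨b]∧c ⟩
    a ∧ₛ ((b ∨ₛ c) ∧ₛ a)           ≈⟨ a∧[b∧a]≈a∧b ⟩
    a ∧ₛ (b ∨ₛ c)                  ∎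

  a∧[b∧¬[c∧a]]≈a∧[b∧¬c] : a ∧ₛ (b ∧ₛ ¬ₛ (c ∧ₛ a)) ⊢≈ a ∧ₛ (b ∧ₛ ¬ₛ c)
  a∧[b∧¬[c∧a]]≈a∧[b∧¬c] {a} {b} {c} = begin
    a ∧ₛ (b ∧ₛ ¬ₛ (c ∧ₛ a))          ≈⟨ ∧-congˡ ¬[¬a∨b]≈a∧¬b ⟨
    a ∧ₛ ¬ₛ (¬ₛ b ∨ₛ (c ∧ₛ a))       ≈⟨ ¬-cong-under a∧[b∨[c∧a]]≈a∧[b∨c] ⟩
    a ∧ₛ ¬ₛ (¬ₛ b ∨ₛ c)              ≈⟨ ∧-congˡ ¬[¬a∨b]≈a∧¬b ⟩
    a ∧ₛ (b ∧ₛ ¬ₛ c)                 ∎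
    where
    ¬[¬a∨b]≈a∧¬b : ∀ {a b} → ¬ₛ (¬ₛ a ∨ₛ b) ⊢≈ a ∧ₛ ¬ₛ b
    ¬[¬a∨b]≈a∧¬b = trans≈ ¬-∨ (∧-congʳ ¬-involutive)

  -- Weak associativity of `(a ∧ (a ∨ c)) ∧ b`, whose left conjunct absorption folds to `a`.
  a∧[[a∨c]∧[a∧b]]≈a∧b : a ∧ₛ ((a ∨ₛ c) ∧ₛ (a ∧ₛ b)) ⊢≈ a ∧ₛ b
  a∧[[a∨c]∧[a∧b]]≈a∧b {a} {c} {b} = begin
    a ∧ₛ ((a ∨ₛ c) ∧ₛ (a ∧ₛ b))                  ≈⟨ ∧-congˡ (∧-congˡ (∧-congʳ ∧-absorbs-∨)) ⟨
    a ∧ₛ ((a ∨ₛ c) ∧ₛ ((a ∧ₛ (a ∨ₛ c)) ∧ₛ b))    ≈⟨ ∧-weak-assoc ⟨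
    (a ∧ₛ (a ∨ₛ c)) ∧ₛ b                         ≈⟨ ∧-congʳ ∧-absorbs-∨ ⟩
    a ∧ₛ b                                       ∎

  ∧-memorizes : a ∧ₛ (b ∧ₛ (a ∨ₛ c)) ⊢≈ a ∧ₛ b
  ∧-memorizes {a} {b} {c} = begin
    a ∧ₛ (b ∧ₛ (a ∨ₛ c))            ≈⟨ ∧-congˡ ¬-involutive ⟨
    a ∧ₛ ¬ₛ ¬ₛ (b ∧ₛ (a ∨ₛ c))      ≈⟨ ¬-cong-under negated ⟩
    a ∧ₛ ¬ₛ ¬ₛ b                    ≈⟨ ∧-congˡ ¬-involutive ⟩
    a ∧ₛ b                          ∎
    where
    -- Dropping `a ∨ c` works inside a negated conjunct and under a leading `a ∨ c`, which is
    -- inserted temporarily. `¬-cong-under` then removes the negation.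
    negated : a ∧ₛ ¬ₛ (b ∧ₛ (a ∨ₛ c)) ⊢≈ a ∧ₛ ¬ₛ b
    negated = begin
      a ∧ₛ ¬ₛ (b ∧ₛ (a ∨ₛ c))                          ≈⟨ a∧[[a∨c]∧[a∧b]]≈a∧b ⟨
      a ∧ₛ ((a ∨ₛ c) ∧ₛ (a ∧ₛ ¬ₛ (b ∧ₛ (a ∨ₛ c))))     ≈⟨ ∧-congˡ a∧[b∧¬[c∧a]]≈a∧[b∧¬c] ⟩
      a ∧ₛ ((a ∨ₛ c) ∧ₛ (a ∧ₛ ¬ₛ b))                   ≈⟨ a∧[[a∨c]∧[a∧b]]≈a∧b ⟩
      a ∧ₛ ¬ₛ b                                        ∎

  -- Memorization in dual form: `¬ a ∧ c` is the negation of `a ∨ ¬ c`, a disjunction already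
  -- decided by `a`.
  a∧[b∨[¬a∧c]]≈a∧b : a ∧ₛ (b ∨ₛ (¬ₛ a ∧ₛ c)) ⊢≈ a ∧ₛ b
  a∧[b∨[¬a∧c]]≈a∧b {a} {b} {c} = begin
    a ∧ₛ (b ∨ₛ (¬ₛ a ∧ₛ c))                 ≈⟨ ∧-congˡ (∨-congˡ (∧-congˡ ¬-involutive)) ⟨
    a ∧ₛ (b ∨ₛ (¬ₛ a ∧ₛ ¬ₛ ¬ₛ c))           ≈⟨ ∧-congˡ (∨-congˡ ¬-∨) ⟨
    a ∧ₛ (b ∨ₛ ¬ₛ (a ∨ₛ ¬ₛ c))              ≈⟨ ∧-congˡ (trans≈ ¬-∧ (∨-congʳ ¬-involutive)) ⟨
    a ∧ₛ ¬ₛ (¬ₛ b ∧ₛ (a ∨ₛ ¬ₛ c))           ≈⟨ ¬-cong-under ∧-memorizes ⟩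
    a ∧ₛ ¬ₛ ¬ₛ b                            ≈⟨ ∧-congˡ ¬-involutive ⟩
    a ∧ₛ b                                  ∎

  -- (Mem) splits the inner conjunction, and its branch `¬ a ∧ c` is dead under `a`.
  a∧[[¬a∨b]∧c]≈a∧[b∧c] : a ∧ₛ ((¬ₛ a ∨ₛ b) ∧ₛ c) ⊢≈ a ∧ₛ (b ∧ₛ c)
  a∧[[¬a∨b]∧c]≈a∧[b∧c] {a} {b} {c} = begin
    a ∧ₛ ((¬ₛ a ∨ₛ b) ∧ₛ c)                              ≈⟨ ∧-congˡ ∨-∧-mem ⟩
    a ∧ₛ ((¬ₛ ¬ₛ a ∧ₛ (b ∧ₛ c)) ∨ₛ (¬ₛ a ∧ₛ c))          ≈⟨ a∧[b∨[¬a∧c]]≈a∧b ⟩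
    a ∧ₛ (¬ₛ ¬ₛ a ∧ₛ (b ∧ₛ c))                           ≈⟨ ∧-congˡ (∧-congʳ ¬-involutive) ⟩
    a ∧ₛ (a ∧ₛ (b ∧ₛ c))                                 ≈⟨ a∧[a∧b]≈a∧b ⟩
    a ∧ₛ (b ∧ₛ c)                                        ∎

  ¬a∧[[a∨b]∧c]≈¬a∧[b∧c] : ¬ₛ a ∧ₛ ((a ∨ₛ b) ∧ₛ c) ⊢≈ ¬ₛ a ∧ₛ (b ∧ₛ c)
  ¬a∧[[a∨b]∧c]≈¬a∧[b∧c] =
    trans≈ (∧-congˡ (∧-congʳ (∨-congʳ (sym≈ ¬-involutive)))) a∧[[¬a∨b]∧c]≈a∧[b∧c]

  -- Under a, the terms a ∧ b, ¬ a ∨ (a ∧ b), ¬ a ∨ b and b are interchangeable to the left of c.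
  ∧-assoc : (a ∧ₛ b) ∧ₛ c ⊢≈ a ∧ₛ (b ∧ₛ c)
  ∧-assoc {a} {b} {c} = begin
    (a ∧ₛ b) ∧ₛ c                      ≈⟨ a∧[[a∧b]∧c]≈[a∧b]∧c ⟨
    a ∧ₛ ((a ∧ₛ b) ∧ₛ c)               ≈⟨ a∧[[¬a∨b]∧c]≈a∧[b∧c] ⟨
    a ∧ₛ ((¬ₛ a ∨ₛ (a ∧ₛ b)) ∧ₛ c)     ≈⟨ ∧-congˡ (∧-congʳ ¬a∨[a∧b]≈¬a∨b) ⟩
    a ∧ₛ ((¬ₛ a ∨ₛ b) ∧ₛ c)            ≈⟨ a∧[[¬a∨b]∧c]≈a∧[b∧c] ⟩
    a ∧ₛ (b ∧ₛ c)                      ∎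
    where
    ¬a∨[a∧b]≈¬a∨b : ¬ₛ a ∨ₛ (a ∧ₛ b) ⊢≈ ¬ₛ a ∨ₛ b
    ¬a∨[a∧b]≈¬a∨b = begin
      ¬ₛ a ∨ₛ (a ∧ₛ b)                ≈⟨ ∨-congˡ ¬-involutive ⟨
      ¬ₛ a ∨ₛ ¬ₛ ¬ₛ (a ∧ₛ b)          ≈⟨ ¬-∧ ⟨
      ¬ₛ (a ∧ₛ ¬ₛ (a ∧ₛ b))           ≈⟨ cong¬ a∧¬[a∧b]≈a∧¬b ⟩
      ¬ₛ (a ∧ₛ ¬ₛ b)                  ≈⟨ ¬-∧ ⟩
      ¬ₛ a ∨ₛ ¬ₛ ¬ₛ b                 ≈⟨ ∨-congˡ ¬-involutive ⟩
      ¬ₛ a ∨ₛ b                       ∎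

  -- Conditionals and distributivity

  -- Both sides read: if `a` then `b` else `c`. Memorization removes the second test of `a` from the
  -- true branch.
  [¬a∨b]∧[a∨c]≈[a∧b]∨[¬a∧c] : (¬ₛ a ∨ₛ b) ∧ₛ (a ∨ₛ c) ⊢≈ (a ∧ₛ b) ∨ₛ (¬ₛ a ∧ₛ c)
  [¬a∨b]∧[a∨c]≈[a∧b]∨[¬a∧c] {a} {b} {c} = begin
    (¬ₛ a ∨ₛ b) ∧ₛ (a ∨ₛ c)                                  ≈⟨ ∨-∧-mem ⟩
    (¬ₛ ¬ₛ a ∧ₛ (b ∧ₛ (a ∨ₛ c))) ∨ₛ (¬ₛ a ∧ₛ (a ∨ₛ c))       ≈⟨ ∨-congʳ (∧-congʳ ¬-involutive) ⟩
    (a ∧ₛ (b ∧ₛ (a ∨ₛ c))) ∨ₛ (¬ₛ a ∧ₛ (a ∨ₛ c))             ≈⟨ cong∨ ∧-memorizes ¬a∧[a∨b]≈¬a∧b ⟩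
    (a ∧ₛ b) ∨ₛ (¬ₛ a ∧ₛ c)                                  ∎

  -- In its conjunctive form the conditional can be reassociated so that `d` joins the second
  -- factor; (Mem) on the first factor then carries `d` into both branches.
  conditional-∧ : ((a ∧ₛ b) ∨ₛ (¬ₛ a ∧ₛ c)) ∧ₛ d ⊢≈ (a ∧ₛ (b ∧ₛ d)) ∨ₛ (¬ₛ a ∧ₛ (c ∧ₛ d))
  conditional-∧ {a} {b} {c} {d} = begin
    ((a ∧ₛ b) ∨ₛ (¬ₛ a ∧ₛ c)) ∧ₛ d                                      ≈⟨ ∧-congʳ [¬a∨b]∧[a∨c]≈[a∧b]∨[¬a∧c] ⟨
    ((¬ₛ a ∨ₛ b) ∧ₛ (a ∨ₛ c)) ∧ₛ d                                      ≈⟨ ∧-assoc ⟩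
    (¬ₛ a ∨ₛ b) ∧ₛ ((a ∨ₛ c) ∧ₛ d)                                      ≈⟨ ∨-∧-mem ⟩
    (¬ₛ ¬ₛ a ∧ₛ (b ∧ₛ ((a ∨ₛ c) ∧ₛ d))) ∨ₛ (¬ₛ a ∧ₛ ((a ∨ₛ c) ∧ₛ d))    ≈⟨ cong∨ (∧-congʳ ¬-involutive) ¬a∧[[a∨b]∧c]≈¬a∧[b∧c] ⟩
    (a ∧ₛ (b ∧ₛ ((a ∨ₛ c) ∧ₛ d))) ∨ₛ (¬ₛ a ∧ₛ (c ∧ₛ d))                 ≈⟨ ∨-congʳ memorized ⟩
    (a ∧ₛ (b ∧ₛ d)) ∨ₛ (¬ₛ a ∧ₛ (c ∧ₛ d))                               ∎
    where
    memorized : a ∧ₛ (b ∧ₛ ((a ∨ₛ c) ∧ₛ d)) ⊢≈ a ∧ₛ (b ∧ₛ d)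
    memorized = begin
      a ∧ₛ (b ∧ₛ ((a ∨ₛ c) ∧ₛ d))     ≈⟨ ∧-congˡ ∧-assoc ⟨
      a ∧ₛ ((b ∧ₛ (a ∨ₛ c)) ∧ₛ d)     ≈⟨ ∧-assoc ⟨
      (a ∧ₛ (b ∧ₛ (a ∨ₛ c))) ∧ₛ d     ≈⟨ ∧-congʳ ∧-memorizes ⟩
      (a ∧ₛ b) ∧ₛ d                   ≈⟨ ∧-assoc ⟩
      a ∧ₛ (b ∧ₛ d)                   ∎

  [a∧b]∧[a∧c]≈[a∧b]∧c : (a ∧ₛ b) ∧ₛ (a ∧ₛ c) ⊢≈ (a ∧ₛ b) ∧ₛ c
  [a∧b]∧[a∧c]≈[a∧b]∧c {a} {b} {c} = begin
    (a ∧ₛ b) ∧ₛ (a ∧ₛ c)    ≈⟨ ∧-assoc ⟨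
    ((a ∧ₛ b) ∧ₛ a) ∧ₛ c    ≈⟨ ∧-congʳ (trans≈ ∧-assoc a∧[b∧a]≈a∧b) ⟩
    (a ∧ₛ b) ∧ₛ c           ∎

  -- Negation is taken under two different terms: under `a` for the disjunction, and under `a ∧ ¬ b`
  -- for `c`, where `a` has already been tested.
  a∧[b∨[a∧c]]≈a∧[b∨c] : a ∧ₛ (b ∨ₛ (a ∧ₛ c)) ⊢≈ a ∧ₛ (b ∨ₛ c)
  a∧[b∨[a∧c]]≈a∧[b∨c] {a} {b} {c} = begin
    a ∧ₛ (b ∨ₛ (a ∧ₛ c))                ≈⟨ ∧-congˡ ∨-def ⟩
    a ∧ₛ ¬ₛ (¬ₛ b ∧ₛ ¬ₛ (a ∧ₛ c))       ≈⟨ ¬-cong-under negated ⟩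
    a ∧ₛ ¬ₛ (¬ₛ b ∧ₛ ¬ₛ c)              ≈⟨ ∧-congˡ ∨-def ⟨
    a ∧ₛ (b ∨ₛ c)                       ∎
    where
    negated : a ∧ₛ (¬ₛ b ∧ₛ ¬ₛ (a ∧ₛ c)) ⊢≈ a ∧ₛ (¬ₛ b ∧ₛ ¬ₛ c)
    negated = begin
      a ∧ₛ (¬ₛ b ∧ₛ ¬ₛ (a ∧ₛ c))    ≈⟨ ∧-assoc ⟨
      (a ∧ₛ ¬ₛ b) ∧ₛ ¬ₛ (a ∧ₛ c)    ≈⟨ ¬-cong-under [a∧b]∧[a∧c]≈[a∧b]∧c ⟩
      (a ∧ₛ ¬ₛ b) ∧ₛ ¬ₛ c           ≈⟨ ∧-assoc ⟩
      a ∧ₛ (¬ₛ b ∧ₛ ¬ₛ c)           ∎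

  ∧-distribˡ-∨ : a ∧ₛ (b ∨ₛ c) ⊢≈ (a ∧ₛ b) ∨ₛ (a ∧ₛ c)
  ∧-distribˡ-∨ {a} {b} {c} = begin
    -- Putting `a` in front of `c` allows both factors to share the last disjunct `a ∧ c`, as the
    -- dual of (Mem) requires.
    a ∧ₛ (b ∨ₛ c)                                          ≈⟨ a∧[b∨[a∧c]]≈a∧[b∨c] ⟨
    a ∧ₛ (b ∨ₛ (a ∧ₛ c))                                   ≈⟨ [¬a∨b]∧a≈a∧b ⟨
    (¬ₛ a ∨ₛ (b ∨ₛ (a ∧ₛ c))) ∧ₛ a                         ≈⟨ ∧-congˡ ∨-absorbs-∧ ⟨
    (¬ₛ a ∨ₛ (b ∨ₛ (a ∧ₛ c))) ∧ₛ (a ∨ₛ (a ∧ₛ c))           ≈⟨ ∧-∨-mem ⟨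
    (a ∧ₛ b) ∨ₛ (a ∧ₛ c)                                   ∎

theorem3p6 : (A : Set) → A →
    (_⊢≈_ {A} (((x ∧ₛ y) ∨ₛ ((¬ₛ x) ∧ₛ z)) ∧ₛ u) ((x ∧ₛ (y ∧ₛ u)) ∨ₛ ((¬ₛ x) ∧ₛ (z ∧ₛ u))))
    × (_⊢≈_ {A} (x ∧ₛ (y ∨ₛ z)) ((x ∧ₛ y) ∨ₛ (x ∧ₛ z)))
theorem3p6 A _ = conditional-∧ , ∧-distribˡ-∨
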